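{- Let $a=(a_1,a_2,\dots)$ be an infinite sequence of positive integers and let $k\ge 2$ be an integer such that $\gcd(a_1,\dots,a_k)=1$. Put $d_i=\gcd(a_1,\dots,a_i)$ for $i\ge 1$ and define sequences $s^+_i,s^-_i$ ($i\geq 1$) by $$s^+_1=\frac{a_1a_2}{2d_2},\qquad s^+_{i+1}=s^+_i+\frac{d_i}{2d_{i+1}}\,a_{i+1},$$ $$s^-_1=-a_1,\qquad s^-_{i+1}=s^-_i+\left(\frac{d_i}{d_{i+1}}-1\right)a_{i+1}.$$ Then: (i) for every integer $n\ge 0$, $$D^a_k(n)\le \frac{(n+s^+_k)^{k-1}}{(k-1)!\prod_{i=1}^{k}a_i};$$ (ii) for every integer $n\ge 0$ with $n\ge s^-_k$, $$D^a_k(n)\ge \frac{(n-s^-_k)^{k-1}}{(k-1)!\prod_{i=1}^{k}a_i}.$$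
   Context: For an infinite sequence $a=(a_1,a_2,\dots)$ of positive integers, an integer $k\ge1$ and an integer $n\ge 0$, the denumerant $D^a_k(n)$ is the number of $k$-tuples $(x_1,\dots,x_k)$ of non-negative integers with $a_1x_1+\dots+a_kx_k=n$. -}

module Defs where

open import Algebra.Definitions.RawSemiring using () renaming (_^_ to pow)
open import Data.Fin.Base using (toℕ)
open import Data.Integer.Base using (+_)
open import Data.List.Base using (List; [_]; length; filter; upTo; cartesianProductWith)
open import Data.List.Membership.Propositional using (_∈_)
open import Data.List.Membership.Propositional.Properties
  using (∈-filter⁺; ∈-filter⁻; ∈-cartesianProductWith⁺; ∈-upTo⁺)
open import Data.List.Relation.Unary.All using ([])
open import Data.List.Relation.Unary.AllPairs using ([]; _∷_)
open import Data.List.Relation.Unary.Any using (here)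
open import Data.List.Relation.Unary.Unique.Propositional using (Unique)
import Data.List.Relation.Unary.Unique.Propositional.Properties as Uniqueₚ
open import Data.Nat.Base as ℕ using (ℕ; zero; suc; NonZero; _!; s≤s)
open import Data.Nat.GCD using (gcd; gcd[m,n]≢0)
open import Data.Nat.Properties as ℕₚ using (_≟_; _!≢0)
open import Data.Product.Base using (proj₂)
open import Data.Rational.Base using (ℚ; 0ℚ; 1ℚ; ½; _/_; _+_; _-_; _*_; -_; +-*-rawSemiring)
open import Data.Sum.Base using (inj₁)
open import Data.Vec.Base as Vec using (Vec; []; _∷_; tabulate; zipWith; sum; foldr′)
open import Data.Vec.Properties using (∷-injective)
open import Data.Vec.Relation.Unary.All using (All; []; _∷_)
open import Function.Base using (_∘_; it)
open import Function.Bundles using (_⇔_; mk⇔)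
open import Relation.Binary.PropositionalEquality using (_≡_; refl)

-- A sequence (a₁, a₂, …) is stored as a : ℕ → ℕ with a i standing for aᵢ₊₁.
-- The derived quantities prefix, d, ∏, s⁺, s⁻ and D keep their usual indices.

prefix : (ℕ → ℕ) → ∀ k → Vec ℕ k
prefix a k = tabulate (a ∘ toℕ)

-- d a i = gcd(a₁,…,aᵢ), the empty gcd being 0.
d : (ℕ → ℕ) → ℕ → ℕ
d a i = foldr′ gcd 0 (prefix a i)

∏ : (ℕ → ℕ) → ℕ → ℕ
∏ a k = foldr′ ℕ._*_ 1 (prefix a k)

fromℕ : ℕ → ℚ
fromℕ n = + n / 1

infixr 8 _^_
_^_ : ℚ → ℕ → ℚ
_^_ = pow +-*-rawSemiring

weight : (ℕ → ℕ) → ∀ {k} → Vec ℕ k → ℕ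
weight a {k} x = sum (zipWith ℕ._*_ (prefix a k) x)

box : ∀ k → ℕ → List (Vec ℕ k)
box zero    n = [ [] ]
box (suc k) n = cartesianProductWith _∷_ (upTo (suc n)) (box k n)

-- For a positive sequence a the search bound loses nothing: see ∈-solutions
-- and solutions-unique.
solutions : (ℕ → ℕ) → ∀ k → ℕ → List (Vec ℕ k)
solutions a k n = filter (λ x → weight a x ≟ n) (box k n)

D : (ℕ → ℕ) → ℕ → ℕ → ℕ
D a k n = length (solutions a k n)

box-unique : ∀ k n → Unique (box k n)
box-unique zero    n = [] ∷ []
box-unique (suc k) n =
  Uniqueₚ.cartesianProductWith⁺ _∷_ ∷-injective (Uniqueₚ.upTo⁺ (suc n)) (box-unique k n)

∈-box : ∀ {k n} {x : Vec ℕ k} → All (ℕ._≤ n) x → x ∈ box k n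
∈-box []        = here refl
∈-box (p ∷ ps) = ∈-cartesianProductWith⁺ _∷_ (∈-upTo⁺ (s≤s p)) (∈-box ps)

entries≤ : ∀ a .{{_ : ∀ {i} → NonZero (a i)}} {k n} (x : Vec ℕ k) →
           weight a x ℕ.≤ n → All (ℕ._≤ n) x
entries≤ a []       _ = []
entries≤ a (x ∷ xs) p =
  ℕₚ.≤-trans (ℕₚ.m≤n*m x (a 0)) (ℕₚ.m+n≤o⇒m≤o _ p) ∷
  entries≤ (a ∘ suc) xs (ℕₚ.m+n≤o⇒n≤o (a 0 ℕ.* x) p)

∈-solutions : ∀ a .{{_ : ∀ {i} → NonZero (a i)}} {k n} (x : Vec ℕ k) →
              x ∈ solutions a k n ⇔ weight a x ≡ n
∈-solutions a {k} {n} x = mk⇔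
  (λ x∈ → proj₂ (∈-filter⁻ (λ y → weight a y ≟ n) {xs = box k n} x∈))
  (λ eq → ∈-filter⁺ (λ y → weight a y ≟ n) (∈-box (entries≤ a x (ℕₚ.≤-reflexive eq))) eq)

solutions-unique : ∀ a k n → Unique (solutions a k n)
solutions-unique a k n = Uniqueₚ.filter⁺ (λ x → weight a x ≟ n) (box-unique k n)

d≢0 : ∀ a .{{_ : ∀ {i} → NonZero (a i)}} i → NonZero (d a (suc i))
d≢0 a i = ℕ.≢-nonZero (gcd[m,n]≢0 (a 0) (d (a ∘ suc) i) (inj₁ (ℕ.≢-nonZero⁻¹ (a 0))))

∏≢0 : ∀ a .{{_ : ∀ {i} → NonZero (a i)}} k → NonZero (∏ a k)
∏≢0 a zero    = _
∏≢0 a (suc k) = ℕₚ.m*n≢0 (a 0) (∏ (a ∘ suc) k) {{it}} {{∏≢0 (a ∘ suc) k}}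

!*∏≢0 : ∀ m a .{{_ : ∀ {i} → NonZero (a i)}} k → NonZero (m ! ℕ.* ∏ a k)
!*∏≢0 m a k = ℕₚ.m*n≢0 (m !) (∏ a k) {{m !≢0}} {{∏≢0 a k}}

d-ratio : ∀ a .{{_ : ∀ {i} → NonZero (a i)}} → ℕ → ℚ
d-ratio a i = (+ d a i / d a (suc i)) {{d≢0 a i}}

-- s⁺ and s⁻ are indexed from 1; the value at 0 is a dummy.
s⁺ : ∀ a .{{_ : ∀ {i} → NonZero (a i)}} → ℕ → ℚ
s⁺ a 0             = 0ℚ
s⁺ a 1             = ½ * (+ (a 0 ℕ.* a 1) / d a 2) {{d≢0 a 1}}
s⁺ a (suc (suc i)) = s⁺ a (suc i) + ½ * d-ratio a (suc i) * fromℕ (a (suc i))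

s⁻ : ∀ a .{{_ : ∀ {i} → NonZero (a i)}} → ℕ → ℚ
s⁻ a 0             = 0ℚ
s⁻ a 1             = - fromℕ (a 0)
s⁻ a (suc (suc i)) = s⁻ a (suc i) + (d-ratio a (suc i) - 1ℚ) * fromℕ (a (suc i))

{-# OPTIONS --safe #-}

-- Write d = dₖ, d′ = dₖ₊₁, b = aₖ₊₁, g = d / d′ and m = g b, a multiple of d.  Any n divisible
-- by d′ is b j + y with 0 ≤ j < g and d ∣ y, and as D a k is supported on the multiples of d,
-- D a (k+1) n is the sum of D a k (y − m t) over t ≥ 0.  The bounds, with an extra factor dₖ
-- on the side of the power, then follow by induction on k: the sum telescopes by
--   w^k + 2 k h (w+h)^(k−1) ≤ (w+2h)^k,  h = m/2,  for the upper bound,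
--   (w+m)^k ≤ w^k + k m (w+m)^(k−1)                for the lower bound.
-- In the lower bound no term with y − m t < 0 is missed since s⁻ₖ ≥ − dₖ.
module Submission where

module NaturalBounds where

  open import Defs hiding (_^_)
  open import Data.Empty using (⊥-elim)
  open import Data.List.Base as List using (List; []; _∷_; _++_; length)
  open import Data.List.Membership.Propositional using (_∈_)
  open import Data.List.Membership.Propositional.Properties using (∈-map⁺; ∈-map⁻; ∈-++⁺ˡ; ∈-++⁺ʳ; ∈-++⁻)
  open import Data.List.Membership.Propositional.Properties.WithK using (unique∧set⇒bag)
  open import Data.List.Properties using (length-++; length-map)
  open import Data.List.Relation.Binary.BagAndSetEquality using (∼bag⇒↭)
  open import Data.List.Relation.Binary.Permutation.Propositional.Properties using (↭-length)
  open import Data.List.Relation.Unary.AllPairs using ([])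
  open import Data.List.Relation.Unary.Any using (here)
  open import Data.List.Relation.Unary.Unique.Propositional using (Unique)
  import Data.List.Relation.Unary.Unique.Propositional.Properties as Uniqueₚ
  open import Data.Nat.Base
  open import Data.Nat.Coprimality using (Coprime; coprime-divisor; GCD≡1⇒coprime)
  open import Data.Nat.Divisibility
  open import Data.Nat.DivMod using (_/_; _%_; m≡m%n+[m/n]*n; m%n<n; m/n*n≡m; m≥n⇒m/n>0)
  open import Data.Nat.GCD
  open import Data.Nat.Induction using (<-rec)
  open import Data.Nat.Properties
  open import Data.Nat.Tactic.RingSolver using (solve-∀)
  open import Data.Product.Base using (_×_; _,_; proj₂; ∃)
  open import Data.Sum.Base using (_⊎_; inj₁; inj₂)
  open import Data.Vec.Base using (Vec; []; _∷_; _∷ʳ_; init; last; initLast; foldr′)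
  open import Data.Vec.Properties using (init-∷ʳ; last-∷ʳ; ∷ʳ-injective; ∷ʳ-injectiveˡ)
  open import Function.Base using (_∘_)
  open import Function.Bundles using (_⇔_; mk⇔; module Equivalence)
  open import Relation.Binary.PropositionalEquality
  open import Relation.Nullary using (¬_)

  -- Counting solutions and the recurrence for one more part.

  unique∧set⇒length : ∀ {A : Set} {xs ys : List A} → Unique xs → Unique ys →
                      (∀ x → x ∈ xs ⇔ x ∈ ys) → length xs ≡ length ys
  unique∧set⇒length xs! ys! xs∼ys = ↭-length (∼bag⇒↭ (unique∧set⇒bag xs! ys! λ {x} → xs∼ys x))

  weight-∷ʳ : ∀ a {k} (xs : Vec ℕ k) y → weight a (xs ∷ʳ y) ≡ weight a xs + a k * y
  weight-∷ʳ a []       y = +-identityʳ (a 0 * y)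
  weight-∷ʳ a (x ∷ xs) y = trans (cong (a 0 * x +_) (weight-∷ʳ (a ∘ suc) xs y))
                                 (sym (+-assoc (a 0 * x) _ _))

  -- A right fold peels off the first entry, whereas the induction on the number of parts adds the
  -- last one. Associativity and the unit laws reconcile the two, for `gcd` and for the product.
  foldr-prefix : ∀ (_•_ : ℕ → ℕ → ℕ) {e} → (∀ x y z → ((x • y) • z) ≡ (x • (y • z))) →
                 (∀ x → (x • e) ≡ x) → (∀ x → (e • x) ≡ x) → ∀ a k →
                 foldr′ _•_ e (prefix a (suc k)) ≡ (foldr′ _•_ e (prefix a k) • a k)
  foldr-prefix _•_ as idʳ idˡ a zero    = trans (idʳ (a 0)) (sym (idˡ (a 0)))
  foldr-prefix _•_ as idʳ idˡ a (suc k) =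
    trans (cong (a 0 •_) (foldr-prefix _•_ as idʳ idˡ (a ∘ suc) k)) (sym (as (a 0) _ _))

  module _ (a : ℕ → ℕ) .{{a≢0 : ∀ {i} → NonZero (a i)}} (k : ℕ) where

    open Equivalence

    init-last : (v : Vec ℕ (suc k)) → v ≡ init v ∷ʳ last v
    init-last v = proj₂ (proj₂ (initLast v))

    bump : Vec ℕ (suc k) → Vec ℕ (suc k)
    bump v = init v ∷ʳ suc (last v)

    bump-∷ʳ : ∀ (xs : Vec ℕ k) y → bump (xs ∷ʳ y) ≡ xs ∷ʳ suc y
    bump-∷ʳ xs y = cong₂ (λ u z → u ∷ʳ suc z) (init-∷ʳ y xs) (last-∷ʳ y xs)

    bump-injective : ∀ {v w} → bump v ≡ bump w → v ≡ w
    bump-injective {v} {w} eq with p , q ← ∷ʳ-injective (init v) (init w) eq =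
      trans (init-last v) (trans (cong₂ _∷ʳ_ p (suc-injective q)) (sym (init-last w)))

    weight-∷ʳ-suc : ∀ (xs : Vec ℕ k) y → weight a (xs ∷ʳ suc y) ≡ a k + weight a (xs ∷ʳ y)
    weight-∷ʳ-suc xs y = begin
      weight a (xs ∷ʳ suc y)            ≡⟨ weight-∷ʳ a xs (suc y) ⟩
      weight a xs + a k * suc y         ≡⟨ lem (weight a xs) (a k) y ⟩
      a k + (weight a xs + a k * y)     ≡⟨ cong (a k +_) (weight-∷ʳ a xs y) ⟨
      a k + weight a (xs ∷ʳ y)          ∎
      where
      open ≡-Reasoning
      lem : ∀ w b y → w + b * suc y ≡ b + (w + b * y)
      lem = solve-∀

    weight-∷ʳ-zero : ∀ (xs : Vec ℕ k) → weight a (xs ∷ʳ 0) ≡ weight a xs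
    weight-∷ʳ-zero xs = trans (weight-∷ʳ a xs 0)
      (trans (cong (weight a xs +_) (*-zeroʳ (a k))) (+-identityʳ _))

    -- Solutions are split by whether the last coordinate vanishes; L lists those
    -- where it does not, with that coordinate lowered by one.
    D-split : ∀ n (L : List (Vec ℕ (suc k))) → Unique L →
              (∀ v → v ∈ L ⇔ a k + weight a {suc k} v ≡ n) →
              D a (suc k) n ≡ D a k n + length L
    D-split n L L! L∼ = trans
      (unique∧set⇒length (solutions-unique a (suc k) n)
        (Uniqueₚ.++⁺ (Uniqueₚ.map⁺ (λ {v} {w} → ∷ʳ-injectiveˡ v w) (solutions-unique a k n))
                     (Uniqueₚ.map⁺ bump-injective L!) disjoint)
        (λ v → mk⇔ (split v) (join v)))
      (trans (length-++ M) (cong₂ _+_ (length-map _ (solutions a k n)) (length-map bump L)))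
      where
      M : List (Vec ℕ (suc k))
      M = List.map (_∷ʳ 0) (solutions a k n)

      disjoint : ∀ {v} → v ∈ M × v ∈ List.map bump L → _
      disjoint (p , q) with ∈-map⁻ (_∷ʳ 0) p | ∈-map⁻ bump q
      -- One family ends in 0, the other in a successor.
      ... | xs , _ , refl | w , _ , eq with _ , () ← ∷ʳ-injective xs (init w) eq

      split : ∀ v → v ∈ solutions a (suc k) n → v ∈ M ++ List.map bump L
      split v p with initLast v
      ... | xs , zero , refl = ∈-++⁺ˡ (∈-map⁺ (_∷ʳ 0)
        (from (∈-solutions a {k} xs) (trans (sym (weight-∷ʳ-zero xs)) (to (∈-solutions a {suc k} _) p))))
      ... | xs , suc y , refl = ∈-++⁺ʳ M (subst (_∈ List.map bump L) (bump-∷ʳ xs y)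
        (∈-map⁺ bump (from (L∼ (xs ∷ʳ y))
          (trans (sym (weight-∷ʳ-suc xs y)) (to (∈-solutions a {suc k} _) p)))))

      join : ∀ v → v ∈ M ++ List.map bump L → v ∈ solutions a (suc k) n
      join v p with ∈-++⁻ M p
      ... | inj₁ q with xs , r , refl ← ∈-map⁻ (_∷ʳ 0) q =
        from (∈-solutions a {suc k} _) (trans (weight-∷ʳ-zero xs) (to (∈-solutions a {k} xs) r))
      ... | inj₂ q with w , r , refl ← ∈-map⁻ bump q =
        from (∈-solutions a {suc k} _) (trans (weight-∷ʳ-suc (init w) (last w))
          (to (L∼ _) (subst (_∈ L) (init-last w) r)))

    -- A nonzero last coordinate already costs `a k`, so the second family of `D-split` is empty.
    D-small : ∀ {n} → n < a k → D a (suc k) n ≡ D a k n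
    D-small {n} n<a = trans
      (D-split n [] [] λ v → mk⇔ (λ ()) λ eq →
        ⊥-elim (m+n≮m (a k) (weight a v) (subst (_< a k) (sym eq) n<a)))
      (+-identityʳ _)

    D-step : ∀ n → D a (suc k) (a k + n) ≡ D a k (a k + n) + D a (suc k) n
    D-step n = D-split (a k + n) (solutions a (suc k) n) (solutions-unique a (suc k) n) λ v → mk⇔
      (λ p → cong (a k +_) (to (∈-solutions a v) p))
      (λ eq → from (∈-solutions a v) (+-cancelˡ-≡ (a k) _ _ eq))

  -- Convexity inequalities for powers.

  -- Convexity: the tangent to the power function at `w + h` lies below its graph at `w`.
  ^-tangent : ∀ i w h → (w + h) ^ suc i ≤ w ^ suc i + suc i * h * (w + h) ^ i
  ^-tangent zero    w h = ≤-reflexive (lem w h)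
    where
    lem : ∀ w h → (w + h) * 1 ≡ w * 1 + 1 * h * 1
    lem = solve-∀
  ^-tangent (suc i) w h = begin
    (w + h) * (w + h) ^ suc i
      ≤⟨ *-monoʳ-≤ (w + h) (^-tangent i w h) ⟩
    (w + h) * (w ^ suc i + suc i * h * (w + h) ^ i)
      ≡⟨ lem w h (w ^ suc i) ((w + h) ^ i) i ⟩
    w * w ^ suc i + suc i * h * ((w + h) * (w + h) ^ i) + h * w ^ suc i
      ≤⟨ +-monoʳ-≤ (w * w ^ suc i + suc i * h * ((w + h) * (w + h) ^ i))
                   (*-monoʳ-≤ h (^-monoˡ-≤ (suc i) (m≤m+n w h))) ⟩
    w * w ^ suc i + suc i * h * ((w + h) * (w + h) ^ i) + h * (w + h) ^ suc i
      ≡⟨ lem′ w h (w ^ suc i) ((w + h) ^ suc i) i ⟩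
    w ^ suc (suc i) + suc (suc i) * h * (w + h) ^ suc i ∎
    where
    open ≤-Reasoning
    lem : ∀ w h p q i → (w + h) * (p + suc i * h * q) ≡ w * p + suc i * h * ((w + h) * q) + h * p
    lem = solve-∀
    lem′ : ∀ w h p q i → w * p + suc i * h * q + h * q ≡ w * p + suc (suc i) * h * q
    lem′ = solve-∀

  -- Expanding both ends around the midpoint `w + h`, their difference is twice the sum of the terms
  -- odd in `h`, of which only the linear one is kept. In the induction the surplus
  -- `2 * h * (w + h) ^ suc i` is paid for by `^-tangent`.
  ^-chord : ∀ i w h → w ^ suc i + 2 * (suc i * h * (w + h) ^ i) ≤ (w + h + h) ^ suc i
  ^-chord zero    w h = ≤-reflexive (lem w h)
    where
    lem : ∀ w h → w * 1 + 2 * (1 * h * 1) ≡ (w + h + h) * 1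
    lem = solve-∀
  ^-chord (suc i) w h = begin
    w * w ^ suc i + 2 * (suc (suc i) * h * (w + h) ^ suc i)
      ≡⟨ lem w h (w ^ suc i) ((w + h) ^ suc i) i ⟩
    w * w ^ suc i + 2 * (suc i * h * (w + h) ^ suc i) + 2 * h * (w + h) ^ suc i
      ≤⟨ +-monoʳ-≤ (w * w ^ suc i + 2 * (suc i * h * (w + h) ^ suc i))
                   (*-monoʳ-≤ (2 * h) (^-tangent i w h)) ⟩
    w * w ^ suc i + 2 * (suc i * h * ((w + h) * (w + h) ^ i)) +
      2 * h * (w ^ suc i + suc i * h * (w + h) ^ i)
      ≡⟨ lem′ w h (w ^ suc i) ((w + h) ^ i) i ⟩
    (w + h + h) * (w ^ suc i + 2 * (suc i * h * (w + h) ^ i))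
      ≤⟨ *-monoʳ-≤ (w + h + h) (^-chord i w h) ⟩
    (w + h + h) ^ suc (suc i) ∎
    where
    open ≤-Reasoning
    lem : ∀ w h p q i → w * p + 2 * (suc (suc i) * h * q) ≡ w * p + 2 * (suc i * h * q) + 2 * h * q
    lem = solve-∀
    lem′ : ∀ w h p q i → w * p + 2 * (suc i * h * ((w + h) * q)) + 2 * h * (p + suc i * h * q) ≡
           (w + h + h) * (p + 2 * (suc i * h * q))
    lem′ = solve-∀

  -- The base case is 4zh ≤ (z + h)², with `e * e` as the missing square. For each further factor
  -- `z + h`, the summand `h` outweighs the growth of the coefficient because `z ≤ h`.
  ^-peak-below : ∀ i {z h} → z ≤ h → 2 * (suc (suc i) * h * z ^ suc i) ≤ (z + h) ^ suc (suc i)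
  ^-peak-below zero {z} {h} z≤h with e , refl ← m≤n⇒∃[o]m+o≡n z≤h = begin
    2 * (2 * (z + e) * (z * 1))                    ≤⟨ m≤m+n _ (e * e) ⟩
    2 * (2 * (z + e) * (z * 1)) + e * e            ≡⟨ lem z e ⟩
    (z + (z + e)) * ((z + (z + e)) * 1) ∎
    where
    open ≤-Reasoning
    lem : ∀ z e → 2 * (2 * (z + e) * (z * 1)) + e * e ≡ (z + (z + e)) * ((z + (z + e)) * 1)
    lem = solve-∀
  ^-peak-below (suc i) {z} {h} z≤h = begin
    2 * (suc (suc (suc i)) * h * (z * p))
      ≡⟨ lem z h p i ⟩
    2 * (suc (suc i) * h * (z * p)) + 2 * (1 * h * p) * z
      ≤⟨ +-monoʳ-≤ (2 * (suc (suc i) * h * (z * p)))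
           (*-mono-≤ (*-monoʳ-≤ 2 (*-monoˡ-≤ p (*-monoˡ-≤ h (s≤s (z≤n {suc i}))))) z≤h) ⟩
    2 * (suc (suc i) * h * (z * p)) + 2 * (suc (suc i) * h * p) * h
      ≡⟨ lem′ z h p i ⟩
    (z + h) * (2 * (suc (suc i) * h * p))
      ≤⟨ *-monoʳ-≤ (z + h) (^-peak-below i z≤h) ⟩
    (z + h) ^ suc (suc (suc i)) ∎
    where
    open ≤-Reasoning
    p = z ^ suc i
    lem : ∀ z h p i → 2 * (suc (suc (suc i)) * h * (z * p)) ≡
          2 * (suc (suc i) * h * (z * p)) + 2 * (1 * h * p) * z
    lem = solve-∀
    lem′ : ∀ z h p i → 2 * (suc (suc i) * h * (z * p)) + 2 * (suc (suc i) * h * p) * h ≡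
           (z + h) * (2 * (suc (suc i) * h * p))
    lem′ = solve-∀

  -- This starts the telescoping of the upper bound, where a single term must fit. If `h ≤ z` it is
  -- `^-chord` at `w = z − h` with `w ^ suc i` dropped. At `i = 0` it reads 2h ≤ z + h, hence the
  -- disjunction.
  ^-peak : ∀ i {z h} → 1 ≤ i ⊎ h ≤ z → 2 * (suc i * h * z ^ i) ≤ (z + h) ^ suc i
  ^-peak i {z} {h} (inj₂ h≤z) with z ∸ h | m∸n+n≡m h≤z
  ... | w | refl = ≤-trans (m≤n+m _ (w ^ suc i)) (^-chord i w h)
  ^-peak (suc i) {z} {h} (inj₁ _) with ≤-total z h
  ... | inj₁ z≤h = ^-peak-below i z≤h
  ... | inj₂ h≤z = ^-peak (suc i) (inj₂ h≤z)

  -- Residues modulo `d` of the multiples of `b`.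

  split-≤ : ∀ {m n} → m ≤ n → ∃ λ e → n ≡ m + e
  split-≤ m≤n with e , eq ← m≤n⇒∃[o]m+o≡n m≤n = e , sym eq

  -- The quotient g is given as `suc g′`, so that it is visibly positive and residues are indexed by
  -- `j ≤ g′`.
  module Gcd (d b g′ : ℕ) .{{_ : NonZero d}} (d≡ : d ≡ suc g′ * gcd d b) where

    δ b′ : ℕ
    δ = gcd d b
    b′ = quotient (gcd[m,n]∣n d b)

    b≡ : b ≡ b′ * δ
    b≡ = _∣_.equality (gcd[m,n]∣n d b)

    instance
      δ≢0 : NonZero δ
      δ≢0 = ≢-nonZero (gcd[m,n]≢0 d b (inj₁ (≢-nonZero⁻¹ d)))

    b*g≡ : b * suc g′ ≡ b′ * d
    b*g≡ = trans (cong (_* suc g′) b≡)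
      (trans (*-assoc b′ δ (suc g′)) (cong (b′ *_) (trans (*-comm δ (suc g′)) (sym d≡))))

    d∣b*g : d ∣ b * suc g′
    d∣b*g = divides b′ b*g≡

    coprime : Coprime (suc g′) b′
    coprime = GCD≡1⇒coprime (GCD-* (subst₂ (λ x y → GCD x y (1 * δ)) d≡ b≡
      (subst (GCD d b) (sym (*-identityˡ δ)) (gcd-GCD d b))))

    -- Cancel `δ` and use that `suc g′` is coprime to `b′`. Consequently `b * j` is not a multiple
    -- of `d` for 0 < j < g.
    d∣b*j⇒g∣j : ∀ j → d ∣ b * j → suc g′ ∣ j
    d∣b*j⇒g∣j j p = coprime-divisor coprime (*-cancelʳ-∣ δ (subst₂ _∣_ d≡ eq p))
      where
      eq : b * j ≡ b′ * j * δ
      eq = trans (cong (_* j) b≡) (lem b′ δ j)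
        where
        lem : ∀ x y z → x * y * z ≡ x * z * y
        lem = solve-∀

    -- n = b j + y for some multiple y of d, which may be negative.
    Residue : ℕ → ℕ → Set
    Residue n j = (∃ λ y → d ∣ y × n ≡ b * j + y) ⊎ (∃ λ z → 0 < z × d ∣ z × n + z ≡ b * j)

    -- The hypothesis is n = (v - u)d + bJ without negative numbers. Reducing `J` modulo g only
    -- changes the multiple of `d`, by `b*g≡`; comparing `u` with the new coefficient `v′` gives the
    -- sign of the remaining multiple.
    reduce : ∀ {n} u v J → n + u * d ≡ v * d + b * J → ∃ λ j → j ≤ g′ × Residue n j
    reduce {n} u v J eq = j , s≤s⁻¹ (m%n<n J (suc g′)) , residue (≤-<-connex u v′)
      where
      open ≡-Reasoning
      j t v′ : ℕ
      j = J % suc g′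
      t = J / suc g′
      v′ = v + t * b′

      eq′ : n + u * d ≡ b * j + v′ * d
      eq′ = begin
        n + u * d                      ≡⟨ eq ⟩
        v * d + b * J                  ≡⟨ cong (λ x → v * d + b * x) (m≡m%n+[m/n]*n J (suc g′)) ⟩
        v * d + b * (j + t * suc g′)   ≡⟨ lem v d b j t (suc g′) ⟩
        b * j + (v * d + t * (b * suc g′)) ≡⟨ cong (λ x → b * j + (v * d + t * x)) b*g≡ ⟩
        b * j + (v * d + t * (b′ * d)) ≡⟨ lem′ (b * j) v d t b′ ⟩
        b * j + v′ * d                 ∎
        where
        lem : ∀ v d b j t g → v * d + b * (j + t * g) ≡ b * j + (v * d + t * (b * g))
        lem = solve-∀
        lem′ : ∀ x v d t b′ → x + (v * d + t * (b′ * d)) ≡ x + (v + t * b′) * d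
        lem′ = solve-∀

      residue : u ≤ v′ ⊎ v′ < u → Residue n j
      residue (inj₁ u≤v′) with e , v′≡ ← split-≤ u≤v′ = inj₁ (e * d , n∣m*n e ,
        +-cancelʳ-≡ (u * d) n _ (trans eq′ (trans (cong (λ x → b * j + x * d) v′≡) (lem (b * j) u e d))))
        where
        lem : ∀ x u e d → x + (u + e) * d ≡ x + e * d + u * d
        lem = solve-∀
      residue (inj₂ v′<u) with e , u≡ ← split-≤ v′<u =
        inj₂ (suc e * d , m≤n⇒m≤n+o (e * d) (>-nonZero⁻¹ d) , n∣m*n (suc e) ,
        +-cancelʳ-≡ (v′ * d) _ _ (trans (lem n e d v′) (trans (cong (λ x → n + x * d) (sym u≡)) eq′)))
        where
        lem : ∀ n e d v → n + suc e * d + v * d ≡ n + (suc v + e) * d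
        lem = solve-∀

    -- Bézout's identity for `δ`, multiplied by `q = n / δ`; its two sign patterns are the two
    -- cases.
    residue : ∀ {n} → δ ∣ n → ∃ λ j → j ≤ g′ × Residue n j
    residue (divides q refl) with Bézout.identity (gcd-GCD d b)
    ... | Bézout.-+ x y eq = reduce (q * x) 0 (q * y)
      (trans (lem q δ x d) (trans (cong (q *_) eq) (lem′ q y b)))
      where
      lem : ∀ q δ x d → q * δ + q * x * d ≡ q * (δ + x * d)
      lem = solve-∀
      lem′ : ∀ q y b → q * (y * b) ≡ b * (q * y)
      lem′ = solve-∀
    -- b g is a multiple of d, so g − 1 serves as −1.
    ... | Bézout.+- x y eq = reduce (q * y * b′) (q * x) (q * y * g′) (begin
      q * δ + q * y * b′ * d              ≡⟨ lem q δ y b′ d ⟩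
      q * δ + q * y * (b′ * d)            ≡⟨ cong (λ z → q * δ + q * y * z) b*g≡ ⟨
      q * δ + q * y * (b * suc g′)        ≡⟨ lem′ q δ y b g′ ⟩
      q * (δ + y * b) + b * (q * y * g′)  ≡⟨ cong (λ z → q * z + b * (q * y * g′)) eq ⟩
      q * (x * d) + b * (q * y * g′)      ≡⟨ cong (_+ b * (q * y * g′)) (*-assoc q x d) ⟨
      q * x * d + b * (q * y * g′)        ∎)
      where
      open ≡-Reasoning
      lem : ∀ q δ y b′ d → q * δ + q * y * b′ * d ≡ q * δ + q * y * (b′ * d)
      lem = solve-∀
      lem′ : ∀ q δ y b g′ → q * δ + q * y * (b * suc g′) ≡ q * (δ + y * b) + b * (q * y * g′)
      lem′ = solve-∀

  -- With F = D a (i + 1) and N = i! a₁⋯aᵢ₊₁: S stands for 2 s⁺, whence the factor 2 ^ i,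
  -- and R for s⁻ + d, which unlike s⁻ is never negative, so that u = n − s⁻.
  record Bounds (i : ℕ) (F : ℕ → ℕ) (d N S R : ℕ) : Set where
    field
      upper   : ∀ {n} → d ∣ n → 2 ^ i * (F n * N) ≤ d * (2 * n + S) ^ i
      lower   : ∀ {n u} → d ∣ n → u + R ≡ n + d → d * u ^ i ≤ F n * N

  -- G counts with one more part, of size b, than F.
  record AddPart (b : ℕ) (F G : ℕ → ℕ) : Set where
    field
      small : ∀ {n} → n < b → G n ≡ F n
      step  : ∀ n → G (b + n) ≡ F (b + n) + G n

  -- Values of `G` along the residue classes modulo `d`.

  module Step (d b g′ : ℕ) .{{_ : NonZero d}} .{{_ : NonZero b}} (d≡ : d ≡ suc g′ * gcd d b)
              {F G} (add : AddPart b F G) (support : ∀ {n} → ¬ d ∣ n → F n ≡ 0) where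

    open Gcd d b g′ d≡
    open AddPart add

    m : ℕ
    m = b * suc g′

    instance
      m≢0 : NonZero m
      m≢0 = m*n≢0 b (suc g′)

    d∤b*j : ∀ {j} → suc j ≤ g′ → ¬ d ∣ b * suc j
    d∤b*j j<g p = <⇒≱ (s≤s j<g) (∣⇒≤ (d∣b*j⇒g∣j _ p))

    -- Descending from `n` in steps of `b` meets arguments congruent modulo `d` to `b * j`, then to
    -- `b * (j − 1)`, and so on. All lie outside the support of `F` until the multiplier is 0, where
    -- the argument - z is negative.
    vanish : ∀ {n z} j → j ≤ g′ → 0 < z → d ∣ z → n + z ≡ b * j → G n ≡ 0
    vanish {n} {z} zero    _   0<z _   eq =
      ⊥-elim (<⇒≢ 0<z (sym (m+n≡0⇒n≡0 n (trans eq (*-zeroʳ b)))))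
    vanish {n} {z} (suc j) j<g 0<z d∣z eq with ≤-<-connex b n
    ... | inj₂ n<b = trans (small n<b) (support λ d∣n → d∤b*j j<g (subst (d ∣_) eq (∣m∣n⇒∣m+n d∣n d∣z)))
    ... | inj₁ b≤n with l , refl ← split-≤ b≤n = trans (step l) (cong₂ _+_
      (support λ d∣n → d∤b*j j<g (subst (d ∣_) eq (∣m∣n⇒∣m+n d∣n d∣z)))
      (vanish j (<⇒≤ j<g) 0<z d∣z
        (+-cancelˡ-≡ b _ _ (trans (sym (+-assoc b l z)) (trans eq (*-suc b j))))))

    shift-suc : ∀ j y → b * suc j + y ≡ b + (b * j + y)
    shift-suc j y = trans (cong (_+ y) (*-suc b j)) (+-assoc b (b * j) y)

    -- The same descent, now reaching `y`: the `j` steps above it contribute nothing.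
    shift : ∀ {y} j → j ≤ g′ → d ∣ y → G (b * j + y) ≡ G y
    shift {y} zero    _   _   = cong (λ x → G (x + y)) (*-zeroʳ b)
    shift {y} (suc j) j<g d∣y = begin
      G (b * suc j + y)                     ≡⟨ cong G (shift-suc j y) ⟩
      G (b + (b * j + y))                   ≡⟨ step (b * j + y) ⟩
      F (b + (b * j + y)) + G (b * j + y)   ≡⟨ cong₂ _+_ F≡0 (shift j (<⇒≤ j<g) d∣y) ⟩
      G y                                   ∎
      where
      open ≡-Reasoning
      F≡0 : F (b + (b * j + y)) ≡ 0
      F≡0 = support λ p → d∤b*j j<g (∣m+n∣m⇒∣n
        (subst (d ∣_) (trans (sym (shift-suc j y)) (+-comm (b * suc j) y)) p) d∣y)

    -- Of the g steps in one period only the first starts at a multiple of `d`; `shift` skips the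
    -- other `g′`.
    G-period : ∀ {y} → d ∣ y → G (m + y) ≡ F (m + y) + G y
    G-period {y} d∣y rewrite shift-suc g′ y =
      trans (step _) (cong (F _ +_) (shift g′ ≤-refl d∣y))

    G-initial : ∀ {y} → d ∣ y → y < m → G y ≡ F y
    G-initial {y} d∣y y<m with ≤-<-connex b y
    ... | inj₂ y<b = small y<b
    -- After one step the argument is `b * g′` minus the positive multiple m - y of `d`, so `vanish`
    -- applies with `j = g′`.
    ... | inj₁ b≤y with l , refl ← split-≤ b≤y | z , eq ← split-≤ y<m =
      trans (step l) (trans (cong (F (b + l) +_)
        (vanish g′ ≤-refl (s≤s (z≤n {z})) d∣z l+z≡)) (+-identityʳ _))
      where
      m≡ : m ≡ b + l + suc z
      m≡ = trans eq (sym (+-suc (b + l) z))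
      d∣z : d ∣ suc z
      d∣z = ∣m+n∣m⇒∣n (subst (d ∣_) m≡ d∣b*g) d∣y
      l+z≡ : l + suc z ≡ b * g′
      l+z≡ = +-cancelˡ-≡ b _ _ (trans (sym (+-assoc b l (suc z))) (trans (sym m≡) (*-suc b g′)))

    period-induction : (P : ℕ → Set) →
      (∀ {y} → d ∣ y → y < m → P y) →
      (∀ {y} → d ∣ y → P y → P (m + y)) →
      ∀ {y} → d ∣ y → P y
    period-induction P initial next {y} = <-rec (λ y → d ∣ y → P y) go y
      where
      go : ∀ y → (∀ {l} → l < y → d ∣ l → P l) → d ∣ y → P y
      go y rec d∣y with ≤-<-connex m y
      ... | inj₂ y<m = initial d∣y y<m
      ... | inj₁ m≤y with l , refl ← split-≤ m≤y =
        next d∣l (rec (m<n+m l (>-nonZero⁻¹ m)) d∣l)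
        where
        d∣l : d ∣ l
        d∣l = ∣m+n∣m⇒∣n d∣y d∣b*g

  -- The induction step for both bounds.

  module StepBounds (d b g′ : ℕ) .{{_ : NonZero d}} .{{_ : NonZero b}} (d≡ : d ≡ suc g′ * gcd d b)
                    {F G} (add : AddPart b F G) (support : ∀ {n} → ¬ d ∣ n → F n ≡ 0)
                    {i N S R} (F-bounds : Bounds i F d N S R) where

    open Bounds F-bounds
    open Gcd d b g′ d≡
    open Step d b g′ d≡ add support

    N′ : ℕ
    N′ = N * (suc i * b)

    d*b≡δ*m : d * b ≡ δ * m
    d*b≡δ*m = trans (cong (_* b) d≡) (lem (suc g′) δ b)
      where
      lem : ∀ g δ b → g * δ * b ≡ δ * (b * g)
      lem = solve-∀

    -- Passing from `N` to `N′` costs the factor `suc i * b`. Since `d * b ≡ δ * m`, it turns the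
    -- prefactor `d` into `δ` and leaves `suc i * m`, the coefficient in the power inequalities.
    rescale : ∀ p → (suc i * b) * (d * p) ≡ δ * (suc i * m * p)
    rescale p = trans (lem (suc i) b d p) (trans (cong (λ x → suc i * (x * p)) d*b≡δ*m) (lem′ (suc i) δ m p))
      where
      lem : ∀ i b d p → (i * b) * (d * p) ≡ i * (d * b * p)
      lem = solve-∀
      lem′ : ∀ i δ m p → i * (δ * m * p) ≡ δ * (i * m * p)
      lem′ = solve-∀

    F-upper : ∀ {y} → d ∣ y → 2 ^ suc i * (F y * N′) ≤ δ * (2 * (suc i * m * (2 * y + S) ^ i))
    F-upper {y} d∣y = begin
      2 * 2 ^ i * (F y * (N * (suc i * b)))   ≡⟨ lem (2 ^ i) (F y) N (suc i * b) ⟩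
      2 * ((suc i * b) * (2 ^ i * (F y * N))) ≤⟨ *-monoʳ-≤ 2 (*-monoʳ-≤ (suc i * b) (upper d∣y)) ⟩
      2 * ((suc i * b) * (d * p))             ≡⟨ cong (2 *_) (rescale p) ⟩
      2 * (δ * (suc i * m * p))               ≡⟨ lem′ δ (suc i * m * p) ⟩
      δ * (2 * (suc i * m * p))               ∎
      where
      open ≤-Reasoning
      p : ℕ
      p = (2 * y + S) ^ i
      lem : ∀ t f n c → 2 * t * (f * (n * c)) ≡ 2 * (c * (t * (f * n)))
      lem = solve-∀
      lem′ : ∀ δ x → 2 * (δ * x) ≡ δ * (2 * x)
      lem′ = solve-∀

    F-lower : ∀ {y u} → d ∣ y → u + R ≡ y + d → δ * (suc i * m * u ^ i) ≤ F y * N′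
    F-lower {y} {u} d∣y eq = begin
      δ * (suc i * m * u ^ i)     ≡⟨ rescale (u ^ i) ⟨
      (suc i * b) * (d * u ^ i)   ≤⟨ *-monoʳ-≤ (suc i * b) (lower d∣y eq) ⟩
      (suc i * b) * (F y * N)     ≡⟨ lem (suc i * b) (F y) N ⟩
      F y * N′                    ∎
      where
      open ≤-Reasoning
      lem : ∀ c f n → c * (f * n) ≡ f * (n * c)
      lem = solve-∀

    -- For i = 0 the smallest multiple violates the bound unless m ≤ S; this is why s⁺₁ involves a₂.
    module _ (peak-ok : 1 ≤ i ⊎ m ≤ S) where

      -- In the doubled variable one period has length 2m, so the half-step in `^-peak` and
      -- `^-chord` is `m` itself.
      G-upper-multiple : ∀ {y} → d ∣ y → 2 ^ suc i * (G y * N′) ≤ δ * (2 * y + (S + m)) ^ suc i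
      G-upper-multiple = period-induction _ initial next
        where
        open ≤-Reasoning
        initial : ∀ {y} → d ∣ y → y < m → 2 ^ suc i * (G y * N′) ≤ δ * (2 * y + (S + m)) ^ suc i
        initial {y} d∣y y<m = begin
          2 ^ suc i * (G y * N′)                  ≡⟨ cong (λ x → 2 ^ suc i * (x * N′)) (G-initial d∣y y<m) ⟩
          2 ^ suc i * (F y * N′)                  ≤⟨ F-upper d∣y ⟩
          δ * (2 * (suc i * m * (2 * y + S) ^ i)) ≤⟨ *-monoʳ-≤ δ (^-peak i (peak-ok′ peak-ok)) ⟩
          δ * (2 * y + S + m) ^ suc i             ≡⟨ cong (λ x → δ * x ^ suc i) (+-assoc (2 * y) S m) ⟩
          δ * (2 * y + (S + m)) ^ suc i           ∎
          where
          peak-ok′ : 1 ≤ i ⊎ m ≤ S → 1 ≤ i ⊎ m ≤ 2 * y + S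
          peak-ok′ (inj₁ 1≤i) = inj₁ 1≤i
          peak-ok′ (inj₂ m≤S) = inj₂ (m≤n⇒m≤o+n (2 * y) m≤S)
        next : ∀ {y} → d ∣ y → 2 ^ suc i * (G y * N′) ≤ δ * (2 * y + (S + m)) ^ suc i →
               2 ^ suc i * (G (m + y) * N′) ≤ δ * (2 * (m + y) + (S + m)) ^ suc i
        next {y} d∣y hyp = begin
          2 ^ suc i * (G (m + y) * N′)
            ≡⟨ cong (λ x → 2 ^ suc i * (x * N′)) (G-period d∣y) ⟩
          2 ^ suc i * ((F (m + y) + G y) * N′)
            ≡⟨ lem (2 ^ suc i) (F (m + y)) (G y) N′ ⟩
          2 ^ suc i * (G y * N′) + 2 ^ suc i * (F (m + y) * N′)
            ≤⟨ +-mono-≤ hyp (F-upper (∣m∣n⇒∣m+n d∣b*g d∣y)) ⟩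
          δ * w ^ suc i + δ * (2 * (suc i * m * (2 * (m + y) + S) ^ i))
            ≡⟨ cong (λ x → δ * w ^ suc i + δ * (2 * (suc i * m * x ^ i))) (mid m y S) ⟩
          δ * w ^ suc i + δ * (2 * (suc i * m * (w + m) ^ i))
            ≡⟨ *-distribˡ-+ δ (w ^ suc i) _ ⟨
          δ * (w ^ suc i + 2 * (suc i * m * (w + m) ^ i))
            -- The bases `w`, `w + m` and `w + m + m` belong to the bound for `G y`, the bound for
            -- `F (m + y)` and the target.
            ≤⟨ *-monoʳ-≤ δ (^-chord i w m) ⟩
          δ * (w + m + m) ^ suc i
            ≡⟨ cong (λ x → δ * x ^ suc i) (end m y S) ⟩
          δ * (2 * (m + y) + (S + m)) ^ suc i ∎
          where
          w : ℕ
          w = 2 * y + (S + m)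
          lem : ∀ t f g n → t * ((f + g) * n) ≡ t * (g * n) + t * (f * n)
          lem = solve-∀
          mid : ∀ m y S → 2 * (m + y) + S ≡ 2 * y + (S + m) + m
          mid = solve-∀
          end : ∀ m y S → 2 * y + (S + m) + m + m ≡ 2 * (m + y) + (S + m)
          end = solve-∀

      -- Either `G n` is 0, or it equals `G y` for a multiple `y ≤ n` of `d`, and the bound is
      -- monotone.
      G-upper : ∀ {n} → δ ∣ n → 2 ^ suc i * (G n * N′) ≤ δ * (2 * n + (S + m)) ^ suc i
      G-upper {n} δ∣n with residue δ∣n
      ... | j , j≤g , inj₂ (z , 0<z , d∣z , eq)
        rewrite vanish j j≤g 0<z d∣z eq | *-zeroʳ (2 ^ suc i) = z≤n
      ... | j , j≤g , inj₁ (y , d∣y , refl) = begin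
        2 ^ suc i * (G (b * j + y) * N′)  ≡⟨ cong (λ x → 2 ^ suc i * (x * N′)) (shift j j≤g d∣y) ⟩
        2 ^ suc i * (G y * N′)            ≤⟨ G-upper-multiple d∣y ⟩
        δ * (2 * y + (S + m)) ^ suc i
          ≤⟨ *-monoʳ-≤ δ (^-monoˡ-≤ (suc i) (+-monoˡ-≤ (S + m) (*-monoʳ-≤ 2 (m≤n+m y (b * j))))) ⟩
        δ * (2 * (b * j + y) + (S + m)) ^ suc i ∎
        where open ≤-Reasoning

    -- Within one period, a single term of the sum already meets the lower bound.
    short : ∀ {u} → u ≤ m → u ^ suc i ≤ suc i * m * u ^ i
    short {u} u≤m = *-monoˡ-≤ (u ^ i) (≤-trans u≤m (m≤n*m m (suc i)))

    G-lower-multiple : ∀ {y} → d ∣ y → ∀ {u} → u + R ≡ y + d → δ * u ^ suc i ≤ G y * N′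
    G-lower-multiple = period-induction (λ y → ∀ {u} → u + R ≡ y + d → δ * u ^ suc i ≤ G y * N′) initial next
      where
      open ≤-Reasoning
      -- Here d ∣ y < m and d ∣ m give y + d ≤ m.
      initial : ∀ {y} → d ∣ y → y < m → ∀ {u} → u + R ≡ y + d → δ * u ^ suc i ≤ G y * N′
      initial {y} d∣y@(divides q refl) y<m {u} eq = begin
        δ * u ^ suc i            ≤⟨ *-monoʳ-≤ δ (short u≤m) ⟩
        δ * (suc i * m * u ^ i)  ≤⟨ F-lower d∣y eq ⟩
        F y * N′                 ≡⟨ cong (_* N′) (G-initial d∣y y<m) ⟨
        G y * N′                 ∎
        where
        u≤m : u ≤ m
        u≤m = begin
          u           ≤⟨ m≤m+n u R ⟩
          u + R       ≡⟨ eq ⟩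
          q * d + d   ≡⟨ +-comm (q * d) d ⟩
          suc q * d   ≤⟨ *-monoˡ-≤ d (*-cancelʳ-< d q b′ (<-≤-trans y<m (≤-reflexive b*g≡))) ⟩
          b′ * d      ≡⟨ b*g≡ ⟨
          m           ∎
      next : ∀ {y} → d ∣ y → (∀ {u} → u + R ≡ y + d → δ * u ^ suc i ≤ G y * N′) →
             ∀ {u} → u + R ≡ m + y + d → δ * u ^ suc i ≤ G (m + y) * N′
      next {y} d∣y hyp {u} eq with ≤-<-connex m u
      -- The value belonging to `y` would be u - m < 0, so the induction hypothesis says nothing and
      -- `G y` is discarded.
      ... | inj₂ u<m = begin
        δ * u ^ suc i            ≤⟨ *-monoʳ-≤ δ (short (<⇒≤ u<m)) ⟩
        δ * (suc i * m * u ^ i)  ≤⟨ F-lower (∣m∣n⇒∣m+n d∣b*g d∣y) eq ⟩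
        F (m + y) * N′           ≤⟨ *-monoˡ-≤ N′ (m≤m+n (F (m + y)) (G y)) ⟩
        (F (m + y) + G y) * N′   ≡⟨ cong (_* N′) (G-period d∣y) ⟨
        G (m + y) * N′           ∎
      ... | inj₁ m≤u with w , refl ← split-≤ m≤u = begin
        δ * (m + w) ^ suc i
          ≡⟨ cong (λ x → δ * x ^ suc i) (+-comm m w) ⟩
        δ * (w + m) ^ suc i
          ≤⟨ *-monoʳ-≤ δ (^-tangent i w m) ⟩
        δ * (w ^ suc i + suc i * m * (w + m) ^ i)
          ≡⟨ *-distribˡ-+ δ (w ^ suc i) _ ⟩
        δ * w ^ suc i + δ * (suc i * m * (w + m) ^ i)
          ≡⟨ cong (λ x → δ * w ^ suc i + δ * (suc i * m * x ^ i)) (+-comm w m) ⟩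
        δ * w ^ suc i + δ * (suc i * m * (m + w) ^ i)
          ≤⟨ +-mono-≤ (hyp (+-cancelˡ-≡ m _ _ (trans (sym (+-assoc m w R)) (trans eq (+-assoc m y d)))))
                      (F-lower (∣m∣n⇒∣m+n d∣b*g d∣y) eq) ⟩
        G y * N′ + F (m + y) * N′
          ≡⟨ lem (F (m + y)) (G y) N′ ⟩
        (F (m + y) + G y) * N′
          ≡⟨ cong (_* N′) (G-period d∣y) ⟨
        G (m + y) * N′ ∎
        where
        lem : ∀ f g n → g * n + f * n ≡ (f + g) * n
        lem = solve-∀

    module _ {R′} (R′≡ : R′ + g′ * δ ≡ R + g′ * b) where

      -- So `v` is the value that `F`'s bound assigns to n - b g′, the worst residue `j = g′`.
      balance : ∀ {n v} → v + R′ ≡ n + δ → v + (R + b * g′) ≡ n + d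
      balance {n} {v} eq = begin
        v + (R + b * g′)     ≡⟨ cong (λ x → v + (R + x)) (*-comm b g′) ⟩
        v + (R + g′ * b)     ≡⟨ cong (v +_) R′≡ ⟨
        v + (R′ + g′ * δ)    ≡⟨ +-assoc v R′ _ ⟨
        v + R′ + g′ * δ      ≡⟨ cong (_+ g′ * δ) eq ⟩
        n + δ + g′ * δ       ≡⟨ +-assoc n δ _ ⟩
        n + suc g′ * δ       ≡⟨ cong (n +_) d≡ ⟨
        n + d                ∎
        where open ≡-Reasoning

      -- On residues where `G n` is 0 the lower bound must be 0 too. A positive multiple of `d` is
      -- at least `d`, so n + d ≤ b g′, and `R ≥ 0` leaves no room for `v`.
      deficit : ∀ {n v z j} → j ≤ g′ → d ∣ suc z → n + suc z ≡ b * j → v + R′ ≡ n + δ → v ≡ 0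
      deficit {n} {v} {z} {j} j≤g d∣z n+z≡ eq = n≤0⇒n≡0 (+-cancelʳ-≤ (R + b * g′) v 0 (begin
        v + (R + b * g′)   ≡⟨ balance eq ⟩
        n + d              ≤⟨ +-monoʳ-≤ n (∣⇒≤ d∣z) ⟩
        n + suc z          ≡⟨ n+z≡ ⟩
        b * j              ≤⟨ *-monoʳ-≤ b j≤g ⟩
        b * g′             ≤⟨ m≤n+m _ R ⟩
        R + b * g′         ∎))
        where open ≤-Reasoning

      G-lower : ∀ {n v} → δ ∣ n → v + R′ ≡ n + δ → δ * v ^ suc i ≤ G n * N′
      G-lower {n} {v} δ∣n eq with residue δ∣n
      ... | j , j≤g , inj₂ (suc z , 0<z , d∣z , n+z≡)
        rewrite deficit j≤g d∣z n+z≡ eq | *-zeroʳ δ = z≤n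
      G-lower {n} {v} δ∣n eq | j , j≤g , inj₁ (y , d∣y , refl)
        with e , g≡ ← split-≤ j≤g = begin
        -- With `e = g′ − j`, the exact value belonging to `y` is `v + b * e`.
        δ * v ^ suc i            ≤⟨ *-monoʳ-≤ δ (^-monoˡ-≤ (suc i) (m≤m+n v (b * e))) ⟩
        δ * (v + b * e) ^ suc i  ≤⟨ G-lower-multiple d∣y (+-cancelˡ-≡ (b * j) _ _ bal) ⟩
        G y * N′                 ≡⟨ cong (_* N′) (shift j j≤g d∣y) ⟨
        G (b * j + y) * N′       ∎
        where
        open ≤-Reasoning
        lem : ∀ b j e v R → b * j + (v + b * e + R) ≡ v + (R + b * (j + e))
        lem = solve-∀
        bal : b * j + (v + b * e + R) ≡ b * j + (y + d)
        bal = trans (lem b j e v R) (trans (cong (λ x → v + (R + b * x)) (sym g≡))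
          (trans (balance eq) (+-assoc (b * j) y d)))

      G-bounds : 1 ≤ i ⊎ m ≤ S → Bounds (suc i) G δ N′ (S + m) R′
      G-bounds peak-ok = record { upper = G-upper peak-ok ; lower = G-lower }

  -- The bounds for `D` in natural numbers.

  d-suc : ∀ a i → d a (suc i) ≡ gcd (d a i) (a i)
  d-suc = foldr-prefix gcd gcd-assoc gcd-identityʳ gcd-identityˡ

  ∏-suc : ∀ a k → ∏ a (suc k) ≡ ∏ a k * a k
  ∏-suc = foldr-prefix _*_ *-assoc *-identityʳ *-identityˡ

  d-one : ∀ a → d a 1 ≡ a 0
  d-one a = gcd-identityʳ (a 0)

  d∣weight : ∀ a {k} (x : Vec ℕ k) → d a k ∣ weight a x
  d∣weight a []               = ∣-refl
  d∣weight a {suc k} (x ∷ xs) = ∣m∣n⇒∣m+n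
    (∣m⇒∣m*n x (gcd[m,n]∣m (a 0) _))
    (∣-trans (gcd[m,n]∣n (a 0) _) (d∣weight (λ i → a (suc i)) xs))

  module _ (a : ℕ → ℕ) .{{a≢0 : ∀ {i} → NonZero (a i)}} where

    D-add : ∀ k → AddPart (a k) (D a k) (D a (suc k))
    D-add k = record { small = D-small a k ; step = D-step a k }

    ratio∸1 : ℕ → ℕ
    ratio∸1 i = pred ((d a (suc i) / d a (suc (suc i))) {{d≢0 a (suc i)}})

    d-ratio≡ : ∀ i → d a (suc i) ≡ suc (ratio∸1 i) * d a (suc (suc i))
    d-ratio≡ i = sym (trans
      (cong (_* d a (suc (suc i))) (suc-pred _ {{>-nonZero (m≥n⇒m/n>0 (∣⇒≤ δ∣d))}}))
      (m/n*n≡m δ∣d))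
      where
      instance
        _ = d≢0 a i
        _ = d≢0 a (suc i)
      δ∣d : d a (suc (suc i)) ∣ d a (suc i)
      δ∣d = subst (_∣ d a (suc i)) (sym (d-suc a (suc i))) (gcd[m,n]∣m (d a (suc i)) (a (suc i)))

    -- 2 s⁺ᵢ₊₁
    S : ℕ → ℕ
    S zero    = a 1 * suc (ratio∸1 0)
    S (suc i) = S i + a (suc i) * suc (ratio∸1 i)

    -- s⁻ᵢ₊₁ + dᵢ₊₁
    R : ℕ → ℕ
    R zero    = 0
    R (suc i) = R i + ratio∸1 i * (a (suc i) ∸ d a (suc (suc i)))

    -- The truncated subtraction in `R` is exact because `δ` divides `b`. This is the recurrence of
    -- s⁻ after adding the gcds, with no subtraction left.
    R-suc : ∀ i → R (suc i) + ratio∸1 i * d a (suc (suc i)) ≡ R i + ratio∸1 i * a (suc i)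
    R-suc i = begin
      R i + g * (b ∸ δ) + g * δ    ≡⟨ +-assoc (R i) _ _ ⟩
      R i + (g * (b ∸ δ) + g * δ)  ≡⟨ cong (R i +_) (*-distribˡ-+ g (b ∸ δ) δ) ⟨
      R i + g * (b ∸ δ + δ)        ≡⟨ cong (λ x → R i + g * x) (m∸n+n≡m δ≤b) ⟩
      R i + g * b                  ∎
      where
      open ≡-Reasoning
      g b δ : ℕ
      g = ratio∸1 i
      b = a (suc i)
      δ = d a (suc (suc i))
      δ≤b : δ ≤ b
      δ≤b = ∣⇒≤ (subst (_∣ b) (sym (d-suc a (suc i))) (gcd[m,n]∣n (d a (suc i)) (a (suc i))))

    D-support : ∀ k {n} → ¬ d a k ∣ n → D a k n ≡ 0
    D-support k {n} d∤n with solutions a k n in eq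
    ... | []    = refl
    ... | x ∷ _ = ⊥-elim (d∤n (subst (d a k ∣_)
      (Equivalence.to (∈-solutions a x) (subst (x ∈_) (sym eq) (here refl))) (d∣weight a x)))

    D-zero : ∀ n .{{_ : NonZero n}} → D a 0 n ≡ 0
    D-zero (suc n) = refl

    D-one : ∀ {n} → d a 1 ∣ n → D a 1 n ≡ 1
    D-one (divides q refl) rewrite d-one a = go q
      where
      go : ∀ q → D a 1 (q * a 0) ≡ 1
      go zero    = D-small a 0 (>-nonZero⁻¹ (a 0))
      go (suc q) = trans (D-step a 0 (q * a 0))
        (cong₂ _+_ (D-zero (a 0 + q * a 0) {{>-nonZero (m≤n⇒m≤n+o (q * a 0) (>-nonZero⁻¹ (a 0)))}}) (go q))

    D-one-scaled : ∀ {n} → d a 1 ∣ n → D a 1 n * (1 * ∏ a 1) ≡ d a 1 * 1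
    D-one-scaled d∣n = trans (cong (_* (1 * ∏ a 1)) (D-one d∣n))
      (trans (lem (a 0)) (cong (_* 1) (sym (d-one a))))
      where
      lem : ∀ x → 1 * (1 * (x * 1)) ≡ x * 1
      lem = solve-∀

    D-bounds : ∀ i → Bounds i (D a (suc i)) (d a (suc i)) (i ! * ∏ a (suc i)) (S i) (R i)
    D-bounds zero = record
      -- With one part there is exactly one solution and all powers have exponent 0, so both bounds
      -- are equalities.
      { upper = λ d∣n → ≤-reflexive (trans (*-identityˡ _) (D-one-scaled d∣n))
      ; lower = λ d∣n _ → ≤-reflexive (sym (D-one-scaled d∣n))
      }
    D-bounds (suc i) = subst₂ (λ δ N → Bounds (suc i) (D a (suc (suc i))) δ N (S (suc i)) (R (suc i)))
      (sym (d-suc a (suc i))) N≡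
      (StepBounds.G-bounds (d a (suc i)) (a (suc i)) (ratio∸1 i)
        (trans (d-ratio≡ i) (cong (suc (ratio∸1 i) *_) (d-suc a (suc i))))
        (D-add (suc i)) (D-support (suc i)) (D-bounds i)
        (subst (λ δ → R (suc i) + ratio∸1 i * δ ≡ R i + ratio∸1 i * a (suc i)) (d-suc a (suc i)) (R-suc i))
        (peak-ok i))
      where
      instance _ = d≢0 a i
      N≡ : i ! * ∏ a (suc i) * (suc i * a (suc i)) ≡ suc i ! * ∏ a (suc (suc i))
      N≡ = trans (lem (i !) (∏ a (suc i)) (suc i) (a (suc i)))
        (cong (suc i ! *_) (sym (∏-suc a (suc i))))
        where
        lem : ∀ f p j b → f * p * (j * b) ≡ j * f * (p * b)
        lem = solve-∀
      peak-ok : ∀ i → 1 ≤ i ⊎ a (suc i) * suc (ratio∸1 i) ≤ S i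
      -- `S 0` is by definition the first period.
      peak-ok zero    = inj₂ ≤-refl
      peak-ok (suc i) = inj₁ (s≤s z≤n)

open import Algebra.Bundles using (CommutativeRing)
open import Data.Integer.Base as ℤ using (+_; +≤+)
open import Data.Integer.Properties using (pos-*; pos-+; drop‿+≤+)
open import Data.Nat.Base as ℕ using (ℕ; zero; suc; NonZero; _∸_; _!)
open import Data.Nat.Divisibility using (_∣_; 1∣_)
import Data.Nat.Properties as ℕₚ
open import Data.Nat.Tactic.RingSolver using (solve-∀)
open import Data.Product.Base using (_×_; _,_)
open import Data.Rational.Base using (ℚ; 1ℚ; ½; _≤_; _+_; _-_; _*_; _/_; -_; Positive; toℚᵘ)
open import Data.Rational.Properties hiding (_≟_)
open import Data.Rational.Solver using (module +-*-Solver)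
import Data.Rational.Unnormalised.Base as ℚᵘ
import Data.Rational.Unnormalised.Properties as ℚᵘₚ
open import Defs
open import Relation.Binary.PropositionalEquality
import Algebra.Properties.CommutativeSemiring.Exp
  (CommutativeRing.commutativeSemiring +-*-commutativeRing) as Exp

open NaturalBounds using
  (Bounds; D-bounds; S; R; R-suc; ratio∸1; d-ratio≡; d-one)

-- The embedding of the naturals in the rationals.

/-quotient : ∀ q {m} n .{{_ : NonZero n}} → m ≡ q ℕ.* n → + m / n ≡ fromℕ q
/-quotient q {m} (suc n) eq = fromℚᵘ-cong {ℚᵘ.mkℚᵘ (+ m) n} {ℚᵘ.mkℚᵘ (+ q) 0} (ℚᵘ.*≡* (begin
  + m ℤ.* + 1           ≡⟨ pos-* m 1 ⟨
  + (m ℕ.* 1)           ≡⟨ cong +_ (trans (ℕₚ.*-identityʳ m) eq) ⟩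
  + (q ℕ.* suc n)       ≡⟨ pos-* q (suc n) ⟩
  + q ℤ.* + suc n       ∎))
  where open ≡-Reasoning

-- Normalisation by a gcd does not compute on variables, so the laws of `fromℕ` are checked on
-- unnormalised fractions with denominator 1, encoded as 0.
toℚᵘ-fromℕ : ∀ n → toℚᵘ (fromℕ n) ℚᵘ.≃ ℚᵘ.mkℚᵘ (+ n) 0
toℚᵘ-fromℕ n = toℚᵘ-fromℚᵘ (ℚᵘ.mkℚᵘ (+ n) 0)

fromℕ-+ : ∀ m n → fromℕ (m ℕ.+ n) ≡ fromℕ m + fromℕ n
fromℕ-+ m n = toℚᵘ-injective (begin
  toℚᵘ (fromℕ (m ℕ.+ n))                      ≈⟨ toℚᵘ-fromℕ (m ℕ.+ n) ⟩
  ℚᵘ.mkℚᵘ (+ (m ℕ.+ n)) 0                     ≈⟨ ℚᵘ.*≡* (cong (ℤ._* + 1) (trans (pos-+ m n)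
    (sym (cong₂ ℤ._+_ (trans (sym (pos-* m 1)) (cong +_ (ℕₚ.*-identityʳ m)))
                      (trans (sym (pos-* n 1)) (cong +_ (ℕₚ.*-identityʳ n))))))) ⟩
  ℚᵘ.mkℚᵘ (+ m) 0 ℚᵘ.+ ℚᵘ.mkℚᵘ (+ n) 0        ≈⟨ ℚᵘₚ.+-cong (toℚᵘ-fromℕ m) (toℚᵘ-fromℕ n) ⟨
  toℚᵘ (fromℕ m) ℚᵘ.+ toℚᵘ (fromℕ n)          ≈⟨ toℚᵘ-homo-+ (fromℕ m) (fromℕ n) ⟨
  toℚᵘ (fromℕ m + fromℕ n)                    ∎)
  where open ℚᵘₚ.≃-Reasoning

fromℕ-* : ∀ m n → fromℕ (m ℕ.* n) ≡ fromℕ m * fromℕ n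
fromℕ-* m n = toℚᵘ-injective (begin
  toℚᵘ (fromℕ (m ℕ.* n))                      ≈⟨ toℚᵘ-fromℕ (m ℕ.* n) ⟩
  ℚᵘ.mkℚᵘ (+ (m ℕ.* n)) 0                     ≈⟨ ℚᵘ.*≡* (cong (ℤ._* + 1) (pos-* m n)) ⟩
  ℚᵘ.mkℚᵘ (+ m) 0 ℚᵘ.* ℚᵘ.mkℚᵘ (+ n) 0        ≈⟨ ℚᵘₚ.*-cong (toℚᵘ-fromℕ m) (toℚᵘ-fromℕ n) ⟨
  toℚᵘ (fromℕ m) ℚᵘ.* toℚᵘ (fromℕ n)          ≈⟨ toℚᵘ-homo-* (fromℕ m) (fromℕ n) ⟨
  toℚᵘ (fromℕ m * fromℕ n)                    ∎)
  where open ℚᵘₚ.≃-Reasoning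

fromℕ-mono-≤ : ∀ {m n} → m ℕ.≤ n → fromℕ m ≤ fromℕ n
fromℕ-mono-≤ {m} {n} m≤n = toℚᵘ-cancel-≤ (begin
  toℚᵘ (fromℕ m)     ≃⟨ toℚᵘ-fromℕ m ⟩
  ℚᵘ.mkℚᵘ (+ m) 0    ≤⟨ ℚᵘ.*≤* (subst₂ ℤ._≤_ (pos-* m 1) (pos-* n 1) (+≤+ (ℕₚ.*-monoˡ-≤ 1 m≤n))) ⟩
  ℚᵘ.mkℚᵘ (+ n) 0    ≃⟨ toℚᵘ-fromℕ n ⟨
  toℚᵘ (fromℕ n)     ∎)
  where open ℚᵘₚ.≤-Reasoning

fromℕ-cancel-≤ : ∀ {m n} → fromℕ m ≤ fromℕ n → m ℕ.≤ n
fromℕ-cancel-≤ {m} {n} p = ℕₚ.*-cancelʳ-≤ m n 1 (drop‿+≤+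
  (subst₂ ℤ._≤_ (sym (pos-* m 1)) (sym (pos-* n 1)) (ℚᵘₚ.drop-*≤* (begin
    ℚᵘ.mkℚᵘ (+ m) 0    ≃⟨ toℚᵘ-fromℕ m ⟨
    toℚᵘ (fromℕ m)     ≤⟨ toℚᵘ-mono-≤ p ⟩
    toℚᵘ (fromℕ n)     ≃⟨ toℚᵘ-fromℕ n ⟩
    ℚᵘ.mkℚᵘ (+ n) 0    ∎))))
  where open ℚᵘₚ.≤-Reasoning

fromℕ-^ : ∀ m i → fromℕ (m ℕ.^ i) ≡ fromℕ m ^ i
fromℕ-^ m zero    = refl
fromℕ-^ m (suc i) = trans (fromℕ-* m (m ℕ.^ i)) (cong (fromℕ m *_) (fromℕ-^ m i))

fromℕ-positive : ∀ n .{{_ : NonZero n}} → Positive (fromℕ n)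
fromℕ-positive (suc n) = normalize-pos (suc n) 1

1/n*n≡1 : ∀ n .{{_ : NonZero n}} → (+ 1 / n) * fromℕ n ≡ 1ℚ
1/n*n≡1 n@(suc k) = toℚᵘ-injective (begin
  toℚᵘ ((+ 1 / n) * fromℕ n)                 ≈⟨ toℚᵘ-homo-* (+ 1 / n) (fromℕ n) ⟩
  toℚᵘ (+ 1 / n) ℚᵘ.* toℚᵘ (fromℕ n)         ≈⟨ ℚᵘₚ.*-cong
    (toℚᵘ-fromℚᵘ (ℚᵘ.mkℚᵘ (+ 1) k)) (toℚᵘ-fromℕ n) ⟩
  ℚᵘ.mkℚᵘ (+ 1) k ℚᵘ.* ℚᵘ.mkℚᵘ (+ n) 0       ≈⟨ ℚᵘ.*≡* (cong +_ (ℕₚ.*-assoc 1 n 1)) ⟩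
  ℚᵘ.1ℚᵘ                                     ∎)
  where open ℚᵘₚ.≃-Reasoning

-- The rational shifts in terms of `S` and `R`.

module _ (a : ℕ → ℕ) .{{a≢0 : ∀ {i} → NonZero (a i)}} where

  open +-*-Solver

  d-ratio-fromℕ : ∀ i → d-ratio a (suc i) ≡ 1ℚ + fromℕ (ratio∸1 a i)
  d-ratio-fromℕ i = trans
    (/-quotient (suc (ratio∸1 a i)) (d a (suc (suc i))) {{d≢0 a (suc i)}} (d-ratio≡ a i))
    (fromℕ-+ 1 (ratio∸1 a i))

  s⁺≡½S : ∀ i → s⁺ a (suc i) ≡ ½ * fromℕ (S a i)
  s⁺≡½S zero = cong (½ *_) (/-quotient (S a 0) (d a 2) {{d≢0 a 1}} (begin
    a 0 ℕ.* a 1                                ≡⟨ cong (ℕ._* a 1) (trans (sym (d-one a)) (d-ratio≡ a 0)) ⟩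
    suc (ratio∸1 a 0) ℕ.* d a 2 ℕ.* a 1        ≡⟨ lem (suc (ratio∸1 a 0)) (d a 2) (a 1) ⟩
    a 1 ℕ.* suc (ratio∸1 a 0) ℕ.* d a 2        ∎))
    where
    open ≡-Reasoning
    lem : ∀ g δ b → g ℕ.* δ ℕ.* b ≡ b ℕ.* g ℕ.* δ
    lem = solve-∀
  s⁺≡½S (suc i) = begin
    s⁺ a (suc i) + ½ * d-ratio a (suc i) * fromℕ b
      ≡⟨ cong₂ (λ s r → s + ½ * r * fromℕ b) (s⁺≡½S i) (trans (d-ratio-fromℕ i) (sym (fromℕ-+ 1 g′))) ⟩
    ½ * fromℕ (S a i) + ½ * fromℕ (suc g′) * fromℕ b
      ≡⟨ solve 4 (λ h s g b → h :* s :+ h :* g :* b := h :* (s :+ b :* g)) refl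
           ½ (fromℕ (S a i)) (fromℕ (suc g′)) (fromℕ b) ⟩
    ½ * (fromℕ (S a i) + fromℕ b * fromℕ (suc g′))
      ≡⟨ cong (λ x → ½ * (fromℕ (S a i) + x)) (fromℕ-* b (suc g′)) ⟨
    ½ * (fromℕ (S a i) + fromℕ (b ℕ.* suc g′))
      ≡⟨ cong (½ *_) (fromℕ-+ (S a i) (b ℕ.* suc g′)) ⟨
    ½ * fromℕ (S a (suc i)) ∎
    where
    open ≡-Reasoning
    b g′ : ℕ
    b = a (suc i)
    g′ = ratio∸1 a i

  fromℕ-+-* : ∀ x y z → fromℕ (x ℕ.+ y ℕ.* z) ≡ fromℕ x + fromℕ y * fromℕ z
  fromℕ-+-* x y z = trans (fromℕ-+ x (y ℕ.* z)) (cong (λ w → fromℕ x + w) (fromℕ-* y z))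

  s⁻+d≡R : ∀ i → s⁻ a (suc i) + fromℕ (d a (suc i)) ≡ fromℕ (R a i)
  s⁻+d≡R zero = trans (cong (λ x → - fromℕ (a 0) + fromℕ x) (d-one a)) (+-inverseˡ (fromℕ (a 0)))
  s⁻+d≡R (suc i) = begin
    s⁻ a (suc i) + (d-ratio a (suc i) - 1ℚ) * fromℕ b + fromℕ δ
      ≡⟨ cong (λ r → s⁻ a (suc i) + (r - 1ℚ) * fromℕ b + fromℕ δ) (d-ratio-fromℕ i) ⟩
    s⁻ a (suc i) + (1ℚ + fromℕ g′ - 1ℚ) * fromℕ b + fromℕ δ
      -- Adding and subtracting `g′ * δ` makes the previous gcd `δ + g′ * δ` appear, as the
      -- induction hypothesis needs; `R-suc` absorbs the surplus.
      ≡⟨ solve 4 (λ s g b δ → s :+ (con 1ℚ :+ g :- con 1ℚ) :* b :+ δ :=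
           s :+ (δ :+ g :* δ) :+ g :* b :- g :* δ) refl (s⁻ a (suc i)) (fromℕ g′) (fromℕ b) (fromℕ δ) ⟩
    s⁻ a (suc i) + (fromℕ δ + fromℕ g′ * fromℕ δ) + fromℕ g′ * fromℕ b - fromℕ g′ * fromℕ δ
      ≡⟨ cong (λ x → s⁻ a (suc i) + x + fromℕ g′ * fromℕ b - fromℕ g′ * fromℕ δ)
           (trans (sym (fromℕ-+-* δ g′ δ)) (cong fromℕ (sym (d-ratio≡ a i)))) ⟩
    s⁻ a (suc i) + fromℕ (d a (suc i)) + fromℕ g′ * fromℕ b - fromℕ g′ * fromℕ δ
      ≡⟨ cong (λ x → x + fromℕ g′ * fromℕ b - fromℕ g′ * fromℕ δ) (s⁻+d≡R i) ⟩
    fromℕ (R a i) + fromℕ g′ * fromℕ b - fromℕ g′ * fromℕ δ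
      ≡⟨ cong (_- fromℕ g′ * fromℕ δ) (trans (sym (fromℕ-+-* (R a i) g′ b))
           (trans (cong fromℕ (sym (R-suc a i))) (fromℕ-+-* (R a (suc i)) g′ δ))) ⟩
    fromℕ (R a (suc i)) + fromℕ g′ * fromℕ δ - fromℕ g′ * fromℕ δ
      ≡⟨ solve 2 (λ r x → r :+ x :- x := r) refl (fromℕ (R a (suc i))) (fromℕ g′ * fromℕ δ) ⟩
    fromℕ (R a (suc i)) ∎
    where
    open ≡-Reasoning
    b g′ δ : ℕ
    b = a (suc i)
    g′ = ratio∸1 a i
    δ = d a (suc (suc i))

-- Division by the normalising constant and the final bounds.

≤-divide : ∀ x D N .{{_ : NonZero N}} → x ≤ fromℕ (D ℕ.* N) → x * (+ 1 / N) ≤ fromℕ D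
≤-divide x D N x≤ = *-cancelʳ-≤-pos (fromℕ N) {{fromℕ-positive N}} (begin
  x * (+ 1 / N) * fromℕ N    ≡⟨ *-assoc x (+ 1 / N) (fromℕ N) ⟩
  x * ((+ 1 / N) * fromℕ N)  ≡⟨ cong (x *_) (1/n*n≡1 N) ⟩
  x * 1ℚ                     ≡⟨ *-identityʳ x ⟩
  x                          ≤⟨ x≤ ⟩
  fromℕ (D ℕ.* N)            ≡⟨ fromℕ-* D N ⟩
  fromℕ D * fromℕ N          ∎)
  where open ≤-Reasoning

divide-≤ : ∀ x D N .{{_ : NonZero N}} → fromℕ (D ℕ.* N) ≤ x → fromℕ D ≤ x * (+ 1 / N)
divide-≤ x D N ≤x = *-cancelʳ-≤-pos (fromℕ N) {{fromℕ-positive N}} (begin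
  fromℕ D * fromℕ N          ≡⟨ fromℕ-* D N ⟨
  fromℕ (D ℕ.* N)            ≤⟨ ≤x ⟩
  x                          ≡⟨ *-identityʳ x ⟨
  x * 1ℚ                     ≡⟨ cong (x *_) (1/n*n≡1 N) ⟨
  x * ((+ 1 / N) * fromℕ N)  ≡⟨ *-assoc x (+ 1 / N) (fromℕ N) ⟨
  x * (+ 1 / N) * fromℕ N    ∎)
  where open ≤-Reasoning

lemma4p1 : (a : ℕ → ℕ) .{{a≢0 : ∀ {i} → NonZero (a i)}} (k : ℕ) → 2 ℕ.≤ k → d a k ≡ 1 →
    let instance _ = !*∏≢0 (k ∸ 1) a k in
    (∀ n → fromℕ (D a k n) ≤ (fromℕ n + s⁺ a k) ^ (k ∸ 1) * (+ 1 / ((k ∸ 1) ! ℕ.* ∏ a k)))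
    ×
    (∀ n → s⁻ a k ≤ fromℕ n →
    (fromℕ n - s⁻ a k) ^ (k ∸ 1) * (+ 1 / ((k ∸ 1) ! ℕ.* ∏ a k)) ≤ fromℕ (D a k n))
lemma4p1 a {{a≢0}} (suc i) _ d≡1 = upper-bound , lower-bound
  where
  open +-*-Solver
  open ≤-Reasoning
  open Bounds (D-bounds a i)

  k N : ℕ
  k = suc i
  N = i ! ℕ.* ∏ a k

  instance
    N≢0 : NonZero N
    N≢0 = !*∏≢0 i a k

  d∣ : ∀ n → d a k ∣ n
  d∣ n = subst (_∣ n) (sym d≡1) (1∣ n)

  upper-bound : ∀ n → fromℕ (D a k n) ≤ (fromℕ n + s⁺ a k) ^ i * (+ 1 / N)
  upper-bound n = divide-≤ (x ^ i) (D a k n) N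
    -- The factor `2 ^ i` from the doubled variable is cancelled against `fromℕ 2 ^ i`.
    (*-cancelˡ-≤-pos (fromℕ (2 ℕ.^ i)) {{fromℕ-positive (2 ℕ.^ i) {{ℕₚ.m^n≢0 2 i}}}} (begin
      fromℕ (2 ℕ.^ i) * fromℕ (D a k n ℕ.* N)   ≡⟨ fromℕ-* (2 ℕ.^ i) (D a k n ℕ.* N) ⟨
      fromℕ (2 ℕ.^ i ℕ.* (D a k n ℕ.* N))       ≤⟨ fromℕ-mono-≤ (upper (d∣ n)) ⟩
      fromℕ (d a k ℕ.* (2 ℕ.* n ℕ.+ S a i) ℕ.^ i)
        ≡⟨ cong fromℕ (trans (cong (ℕ._* (2 ℕ.* n ℕ.+ S a i) ℕ.^ i) d≡1) (ℕₚ.*-identityˡ _)) ⟩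
      fromℕ ((2 ℕ.* n ℕ.+ S a i) ℕ.^ i)         ≡⟨ fromℕ-^ (2 ℕ.* n ℕ.+ S a i) i ⟩
      fromℕ (2 ℕ.* n ℕ.+ S a i) ^ i             ≡⟨ cong (_^ i) 2x≡ ⟩
      (fromℕ 2 * x) ^ i                         ≡⟨ Exp.^-distrib-* (fromℕ 2) x i ⟩
      fromℕ 2 ^ i * x ^ i                       ≡⟨ cong (_* x ^ i) (fromℕ-^ 2 i) ⟨
      fromℕ (2 ℕ.^ i) * x ^ i                   ∎))
    where
    x : ℚ
    x = fromℕ n + s⁺ a k
    2x≡ : fromℕ (2 ℕ.* n ℕ.+ S a i) ≡ fromℕ 2 * x
    2x≡ = begin-equality
      fromℕ (2 ℕ.* n ℕ.+ S a i)                 ≡⟨ fromℕ-+ (2 ℕ.* n) (S a i) ⟩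
      fromℕ (2 ℕ.* n) + fromℕ (S a i)           ≡⟨ cong (_+ fromℕ (S a i)) (fromℕ-* 2 n) ⟩
      fromℕ 2 * fromℕ n + fromℕ (S a i)
        ≡⟨ solve 2 (λ n s → con (fromℕ 2) :* n :+ s := con (fromℕ 2) :* (n :+ con ½ :* s)) refl
             (fromℕ n) (fromℕ (S a i)) ⟩
      fromℕ 2 * (fromℕ n + ½ * fromℕ (S a i))   ≡⟨ cong (λ s → fromℕ 2 * (fromℕ n + s)) (s⁺≡½S a i) ⟨
      fromℕ 2 * x                               ∎

  lower-bound : ∀ n → s⁻ a k ≤ fromℕ n →
                (fromℕ n - s⁻ a k) ^ i * (+ 1 / N) ≤ fromℕ (D a k n)
  lower-bound n s⁻≤n = ≤-divide ((fromℕ n - s⁻ a k) ^ i) (D a k n) N (begin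
    (fromℕ n - s⁻ a k) ^ i    ≡⟨ cong (_^ i) u≡ ⟨
    fromℕ u ^ i               ≡⟨ fromℕ-^ u i ⟨
    fromℕ (u ℕ.^ i)           ≡⟨ cong fromℕ (trans (cong (ℕ._* u ℕ.^ i) d≡1) (ℕₚ.*-identityˡ _)) ⟨
    fromℕ (d a k ℕ.* u ℕ.^ i) ≤⟨ fromℕ-mono-≤ (lower (d∣ n) u+R≡) ⟩
    fromℕ (D a k n ℕ.* N)     ∎)
    where
    -- The assumption n ≥ s⁻ becomes this after adding the gcd to both sides; it makes the
    -- subtraction in `u` exact.
    R≤ : R a i ℕ.≤ n ℕ.+ d a k
    R≤ = fromℕ-cancel-≤ (begin
      fromℕ (R a i)             ≡⟨ s⁻+d≡R a i ⟨
      s⁻ a k + fromℕ (d a k)    ≤⟨ +-monoˡ-≤ (fromℕ (d a k)) s⁻≤n ⟩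
      fromℕ n + fromℕ (d a k)   ≡⟨ fromℕ-+ n (d a k) ⟨
      fromℕ (n ℕ.+ d a k)       ∎)
    u : ℕ
    u = n ℕ.+ d a k ∸ R a i
    u+R≡ : u ℕ.+ R a i ≡ n ℕ.+ d a k
    u+R≡ = ℕₚ.m∸n+n≡m R≤
    u≡ : fromℕ u ≡ fromℕ n - s⁻ a k
    u≡ = begin-equality
      fromℕ u
        ≡⟨ solve 3 (λ u s δ → u := u :+ (s :+ δ) :- (s :+ δ)) refl (fromℕ u) (s⁻ a k) (fromℕ (d a k)) ⟩
      fromℕ u + (s⁻ a k + fromℕ (d a k)) - (s⁻ a k + fromℕ (d a k))
        ≡⟨ cong (λ r → fromℕ u + r - (s⁻ a k + fromℕ (d a k))) (s⁻+d≡R a i) ⟩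
      fromℕ u + fromℕ (R a i) - (s⁻ a k + fromℕ (d a k))
        ≡⟨ cong (_- (s⁻ a k + fromℕ (d a k)))
             (trans (sym (fromℕ-+ u (R a i))) (trans (cong fromℕ u+R≡) (fromℕ-+ n (d a k)))) ⟩
      fromℕ n + fromℕ (d a k) - (s⁻ a k + fromℕ (d a k))
        ≡⟨ solve 3 (λ n s δ → n :+ δ :- (s :+ δ) := n :- s) refl (fromℕ n) (s⁻ a k) (fromℕ (d a k)) ⟩
      fromℕ n - s⁻ a k ∎
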